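{- Let $\Gamma_1$ and $\Gamma_2$ be directed graphs, and let $\Gamma$ be a directed graph with embeddings $f_i:\Gamma\hookrightarrow\Gamma_i$, for $i=1,2$, as a directed subgraph. Suppose given faithful graph weights $(g_i,\lambda_i)$ on the graphs $\Gamma_i$. Consider the graph $\Gamma_1\cup_\Gamma\Gamma_2$ obtained by gluing together the $\Gamma_i$ along the common subgraph $\Gamma$. Then setting $$g(v)=\begin{cases} g_1(v) & v\in V(\Gamma_1)\smallsetminus V(\Gamma)\\ g_2(v) & v\in V(\Gamma_2)\smallsetminus V(\Gamma)\\ g_1(v)+g_2(v) & v\in V(\Gamma)\end{cases}$$ and $$\lambda(e)=\begin{cases}\lambda_1(e) & e\in E(\Gamma_1\smallsetminus\Gamma),\ r(e)\in V(\Gamma_1\smallsetminus\Gamma)\\ \lambda_2(e) & e\in E(\Gamma_2\smallsetminus\Gamma),\ r(e)\in V(\Gamma_2\smallsetminus\Gamma)\\[2mm] \dfrac{\lambda_1(e)g_1(r(e))}{g_1(r(e))+g_2(r(e))} & e\in E(\Gamma_1\smallsetminus\Gamma),\ r(e)\in V(\Gamma)\\[4mm] \dfrac{\lambda_2(e)g_2(r(e))}{g_1(r(e))+g_2(r(e))} & e\in E(\Gamma_2\smallsetminus\Gamma),\ r(e)\in V(\Gamma)\\[4mm] \dfrac{\lambda_1(e)g_1(r(e))+\lambda_2(e)g_2(r(e))}{g_1(r(e))+g_2(r(e))} & e\in E(\Gamma)\end{cases}$$ determines a faithful graph weight $(g,\lambda)$ on the graph $\Gamma_1\cup_\Gamm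a\Gamma_2$.
   Context: For a directed graph $G$, $V(G)$ and $E(G)$ denote its sets of vertices and edges, and $s,r:E(G)\to V(G)$ the source and range maps; a sink is a vertex $v$ with no edge $e$ such that $s(e)=v$. A graph weight on a finite directed graph $G$ is a pair of nonnegative real-valued functions $(g,\lambda)$, with $g$ defined on $V(G)$ and $\lambda$ on $E(G)$, satisfying $g(v)=\sum_{e:\,s(e)=v}\lambda(e)\,g(r(e))$ for each vertex $v$ that is not a sink. It is called faithful if $g$ is never zero. The graph $\Gamma$ is identified with its images in $\Gamma_1$ and $\Gamma_2$ under $f_1$ and $f_2$; $V(\Gamma_i\smallsetminus\Gamma)$ and $E(\Gamma_i\smallsetminus\Gamma)$ denote the vertices and edges of $\Gamma_i$ that are not in $\Gamma$. The graph $\Gamma_1\cup_\Gamma\Gamma_2$ is obtained from the disjoint union of $\Gamma_1$ and $\Gamma_2$ by identifying $f_1(v)$ with $f_2(v)$ for each $v\in V(\Gamma)$ and $f_1(e)$ with $f_2(e)$ for each $e\in E(\Gamma)$.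
   Formalization: Added hypothesis: each vertex of Γ is a sink of Γ₁ if and only if it is a sink of Γ₂; without it the claim fails (e.g. Γ = Γ₁ a single vertex, Γ₂ that vertex with a loop), since the equation at a vertex that is a sink of only one graph is violated. -}

module Defs where

open import Level using (Level; 0ℓ; _⊔_) renaming (suc to lsuc)
open import Data.Nat.Base using (ℕ) renaming (_≤_ to _≤ₙ_)
open import Data.Product.Base using (∃-syntax; _×_; _,_; proj₁; proj₂)
open import Data.Sum.Base using (_⊎_; inj₁; inj₂)
open import Data.List.Base using (List; map; _++_; filter; foldr)
open import Data.List.Relation.Unary.Any using (any?; satisfied)
import Data.List.Relation.Unary.Any as Any
open import Data.List.Relation.Unary.Enumerates.Setoid using (IsEnumeration)
open import Data.List.Relation.Unary.Unique.Setoid using (Unique)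
import Data.List.Relation.Unary.Unique.Setoid.Properties as Uniqueₚ
import Data.List.Membership.Setoid as Membership
import Data.List.Membership.Setoid.Properties as Membershipₚ
open import Function.Bundles using (Func; Injection; _⇔_)
open import Relation.Nullary using (¬_; Dec; yes; no; ¬?; contradiction)
open import Relation.Nullary.Decidable using (map′)
open import Relation.Binary using (Rel; Setoid; DecSetoid; IsEquivalence; IsStrictPartialOrder)
open import Algebra.Bundles using (CommutativeRing)
open import Algebra.Apartness.Bundles using (HeytingField; HeytingCommutativeRing)
import Algebra.Definitions.RawMonoid as RawMonoidDefs

------------------------------------------------------------------------
-- Real numbers

-- The library has no type of reals, so ℝ is an arbitrary model of the axioms
-- of a Cauchy-complete Archimedean ordered field.  Classically such a field is
-- unique up to isomorphism; the axioms are phrased with the apartness _#_ so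
-- that the constructive reals are a model too.  In a classical model x # y is
-- ¬ (x ≈ y), and "x is nonzero" is x # 0# throughout.

record RealNumbers (c ℓ₁ ℓ₂ : Level) : Set (lsuc (c ⊔ ℓ₁ ⊔ ℓ₂)) where
  infix 4 _<_ _≤_
  infixl 7 _/_[_]
  field
    heytingField : HeytingField c ℓ₁ ℓ₂

  open HeytingField heytingField public

  commutativeRing : CommutativeRing c ℓ₁
  commutativeRing = HeytingCommutativeRing.commutativeRing heytingCommutativeRing

  open RawMonoidDefs (CommutativeRing.+-rawMonoid commutativeRing) public
    using () renaming (_×_ to _·_)

  field
    _<_                  : Rel Carrier ℓ₂
    isStrictPartialOrder : IsStrictPartialOrder _≈_ _<_
    #⇒<⊎>                : ∀ {x y} → x # y → x < y ⊎ y < x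
    <⇒#                  : ∀ {x y} → x < y → x # y
    +-monoˡ-<            : ∀ z {x y} → x < y → x + z < y + z
    *-pos                : ∀ {x y} → 0# < x → 0# < y → 0# < x * y
    archimedean          : ∀ x → ∃[ n ] x < n · 1#

  _≤_ : Rel Carrier ℓ₂
  x ≤ y = ¬ (y < x)

  Within : Carrier → Carrier → Carrier → Set ℓ₂
  Within ε x y = (x - y < ε) × (y - x < ε)

  Cauchy : (ℕ → Carrier) → Set (c ⊔ ℓ₂)
  Cauchy x = ∀ ε → 0# < ε →
    ∃[ N ] (∀ m n → N ≤ₙ m → N ≤ₙ n → Within ε (x m) (x n))

  _ConvergesTo_ : (ℕ → Carrier) → Carrier → Set (c ⊔ ℓ₂)
  x ConvergesTo l = ∀ ε → 0# < ε → ∃[ N ] (∀ n → N ≤ₙ n → Within ε (x n) l)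

  field
    complete : ∀ x → Cauchy x → ∃[ l ] (x ConvergesTo l)

  -- #⇒invertible applied to y # 0# inverts y - 0#, which is ≈ y.
  _/_[_] : (x y : Carrier) → y # 0# → Carrier
  x / y [ y#0 ] = x * proj₁ (#⇒invertible y#0)

  sum : List Carrier → Carrier
  sum = foldr _+_ 0#

  private
    module R = CommutativeRing commutativeRing
    module < = IsStrictPartialOrder isStrictPartialOrder

    nonneg∧#0⇒pos : ∀ {x} → 0# ≤ x → x # 0# → 0# < x
    nonneg∧#0⇒pos 0≤x x#0 with #⇒<⊎> x#0
    ... | inj₁ x<0 = contradiction x<0 0≤x
    ... | inj₂ 0<x = 0<x

  +-#0 : ∀ {x y} → 0# ≤ x → x # 0# → 0# ≤ y → y # 0# → x + y # 0#
  +-#0 {x} {y} 0≤x x#0 0≤y y#0 = #-sym (<⇒# (<.trans 0<y y<x+y))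
    where
    0<y : 0# < y
    0<y = nonneg∧#0⇒pos 0≤y y#0

    y<x+y : y < x + y
    y<x+y = <.<-respˡ-≈ (R.+-identityˡ y) (+-monoˡ-< y (nonneg∧#0⇒pos 0≤x x#0))

------------------------------------------------------------------------
-- Finite sets

-- Vertices and edges form setoids rather than types because gluing is a
-- quotient.

record FiniteSetoid : Set₁ where
  field
    decSetoid : DecSetoid 0ℓ 0ℓ

  open DecSetoid decSetoid public

  field
    elements : List Carrier
    complete : IsEnumeration setoid elements
    unique   : Unique setoid elements

module Gluing
  {A B₁ B₂ : FiniteSetoid}
  (ι₁ : Injection (FiniteSetoid.setoid A) (FiniteSetoid.setoid B₁))
  (ι₂ : Injection (FiniteSetoid.setoid A) (FiniteSetoid.setoid B₂))
  where

  private
    module A  = FiniteSetoid A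
    module B₁ = FiniteSetoid B₁
    module B₂ = FiniteSetoid B₂
    module ι₁ = Injection ι₁
    module ι₂ = Injection ι₂

  infix 4 _~_

  -- The identification of ι₁ a with ι₂ a for every a.  Since ι₁ and ι₂ are
  -- injective, these constructors already give an equivalence relation.
  data _~_ : Rel (B₁.Carrier ⊎ B₂.Carrier) 0ℓ where
    inj₁  : ∀ {x x′} → x B₁.≈ x′ → inj₁ x ~ inj₁ x′
    inj₂  : ∀ {y y′} → y B₂.≈ y′ → inj₂ y ~ inj₂ y′
    glue  : ∀ {x y} a → ι₁.to a B₁.≈ x → ι₂.to a B₂.≈ y → inj₁ x ~ inj₂ y
    glue′ : ∀ {x y} a → ι₁.to a B₁.≈ x → ι₂.to a B₂.≈ y → inj₂ y ~ inj₁ x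

  inImage₁? : ∀ x → Dec (∃[ a ] ι₁.to a B₁.≈ x)
  inImage₁? x = map′ satisfied
    (λ (a , p) → Any.map (λ q → B₁.trans (ι₁.cong (A.sym q)) p) (A.complete a))
    (any? (λ a → ι₁.to a B₁.≟ x) A.elements)

  inImage₂? : ∀ y → Dec (∃[ a ] ι₂.to a B₂.≈ y)
  inImage₂? y = map′ satisfied
    (λ (a , p) → Any.map (λ q → B₂.trans (ι₂.cong (A.sym q)) p) (A.complete a))
    (any? (λ a → ι₂.to a B₂.≟ y) A.elements)

  -- B₁ ∖ A, B₂ ∖ A and A cover B₁ ⊔ B₂.
  data Part : Set where
    only₁  : (x : B₁.Carrier) → ¬ (∃[ a ] ι₁.to a B₁.≈ x) → Part
    only₂  : (y : B₂.Carrier) → ¬ (∃[ a ] ι₂.to a B₂.≈ y) → Part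
    shared : A.Carrier → Part

  part : B₁.Carrier ⊎ B₂.Carrier → Part
  part (inj₁ x) with inImage₁? x
  ... | yes (a , _) = shared a
  ... | no x∉A      = only₁ x x∉A
  part (inj₂ y) with inImage₂? y
  ... | yes (a , _) = shared a
  ... | no y∉A      = only₂ y y∉A

  ~-isEquivalence : IsEquivalence _~_
  ~-isEquivalence = record { refl = refl′ ; sym = sym′ ; trans = trans′ }
    where
    refl′ : ∀ {z} → z ~ z
    refl′ {inj₁ x} = inj₁ B₁.refl
    refl′ {inj₂ y} = inj₂ B₂.refl

    sym′ : ∀ {w z} → w ~ z → z ~ w
    sym′ (inj₁ p)      = inj₁ (B₁.sym p)
    sym′ (inj₂ p)      = inj₂ (B₂.sym p)
    sym′ (glue a p q)  = glue′ a p q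
    sym′ (glue′ a p q) = glue a p q

    trans′ : ∀ {u w z} → u ~ w → w ~ z → u ~ z
    trans′ (inj₁ p)      (inj₁ q)      = inj₁ (B₁.trans p q)
    trans′ (inj₁ p)      (glue a q r)  = glue a (B₁.trans q (B₁.sym p)) r
    trans′ (inj₂ p)      (inj₂ q)      = inj₂ (B₂.trans p q)
    trans′ (inj₂ p)      (glue′ a q r) = glue′ a q (B₂.trans r (B₂.sym p))
    trans′ (glue a p q)  (inj₂ r)      = glue a p (B₂.trans q r)
    trans′ (glue a p q)  (glue′ b r s) = inj₁
      (B₁.trans (B₁.sym p)
        (B₁.trans (ι₁.cong (ι₂.injective (B₂.trans q (B₂.sym s)))) r))
    trans′ (glue′ a p q) (inj₁ r)      = glue′ a (B₁.trans p r) q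
    trans′ (glue′ a p q) (glue b r s)  = inj₂
      (B₂.trans (B₂.sym q)
        (B₂.trans (ι₂.cong (ι₁.injective (B₁.trans p (B₁.sym r)))) s))

  private
    glued? : ∀ x y → Dec (∃[ a ] (ι₁.to a B₁.≈ x × ι₂.to a B₂.≈ y))
    glued? x y with inImage₁? x
    ... | no ¬a = no λ (a , p , _) → ¬a (a , p)
    ... | yes (a , p) with ι₂.to a B₂.≟ y
    ...   | yes q = yes (a , p , q)
    ...   | no ¬q = no λ (b , r , s) →
      ¬q (B₂.trans (ι₂.cong (ι₁.injective (B₁.trans p (B₁.sym r)))) s)

  _~?_ : ∀ w z → Dec (w ~ z)
  inj₁ x ~? inj₁ x′ = map′ inj₁ (λ { (inj₁ p) → p }) (x B₁.≟ x′)
  inj₂ y ~? inj₂ y′ = map′ inj₂ (λ { (inj₂ p) → p }) (y B₂.≟ y′)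
  inj₁ x ~? inj₂ y  =
    map′ (λ (a , p , q) → glue a p q) (λ { (glue a p q) → a , p , q }) (glued? x y)
  inj₂ y ~? inj₁ x  =
    map′ (λ (a , p , q) → glue′ a p q) (λ { (glue′ a p q) → a , p , q }) (glued? x y)

  gluedDecSetoid : DecSetoid 0ℓ 0ℓ
  gluedDecSetoid = record
    { Carrier          = B₁.Carrier ⊎ B₂.Carrier
    ; _≈_              = _~_
    ; isDecEquivalence = record { isEquivalence = ~-isEquivalence ; _≟_ = _~?_ }
    }

  private
    S : Setoid 0ℓ 0ℓ
    S = DecSetoid.setoid gluedDecSetoid

  outside? : ∀ y → Dec (¬ (∃[ a ] ι₂.to a B₂.≈ y))
  outside? y = ¬? (inImage₂? y)

  outside-resp : ∀ {y y′} → y B₂.≈ y′ →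
                 ¬ (∃[ a ] ι₂.to a B₂.≈ y) → ¬ (∃[ a ] ι₂.to a B₂.≈ y′)
  outside-resp p ¬a (a , q) = ¬a (a , B₂.trans q (B₂.sym p))

  gluedElements : List (B₁.Carrier ⊎ B₂.Carrier)
  gluedElements = map inj₁ B₁.elements ++ map inj₂ (filter outside? B₂.elements)

  private
    open Membership S using (_∈_)

    gluedComplete : IsEnumeration S gluedElements
    gluedComplete (inj₁ x) = Membershipₚ.∈-++⁺ˡ S
      (Membershipₚ.∈-map⁺ B₁.setoid S inj₁ (B₁.complete x))
    gluedComplete (inj₂ y) with inImage₂? y
    ... | yes (a , p) = Membershipₚ.∈-resp-≈ S {gluedElements}
      (glue a B₁.refl p) (gluedComplete (inj₁ (ι₁.to a)))
    ... | no ¬a = Membershipₚ.∈-++⁺ʳ S (map inj₁ B₁.elements)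
      (Membershipₚ.∈-map⁺ B₂.setoid S inj₂
        (Membershipₚ.∈-filter⁺ B₂.setoid outside? outside-resp (B₂.complete y) ¬a))

    disjoint : ∀ {z} → ¬ (z ∈ map inj₁ B₁.elements ×
                          z ∈ map inj₂ (filter outside? B₂.elements))
    disjoint (z∈₁ , z∈₂)
      with Membershipₚ.∈-map⁻ B₁.setoid S z∈₁ | Membershipₚ.∈-map⁻ B₂.setoid S z∈₂
    ... | x , _ , z~x | y , y∈ , z~y
      with IsEquivalence.trans ~-isEquivalence (IsEquivalence.sym ~-isEquivalence z~x) z~y
    ... | glue a p q = proj₂
      (Membershipₚ.∈-filter⁻ B₂.setoid outside? outside-resp {xs = B₂.elements} y∈) (a , q)

    gluedUnique : Unique S gluedElements
    gluedUnique = Uniqueₚ.++⁺ S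
      (Uniqueₚ.map⁺ B₁.setoid S (λ { (inj₁ p) → p }) B₁.unique)
      (Uniqueₚ.map⁺ B₂.setoid S (λ { (inj₂ p) → p })
        (Uniqueₚ.filter⁺ B₂.setoid outside? B₂.unique))
      disjoint

  glued : FiniteSetoid
  glued = record
    { decSetoid = gluedDecSetoid
    ; elements  = gluedElements
    ; complete  = gluedComplete
    ; unique    = gluedUnique
    }

------------------------------------------------------------------------
-- Finite directed graphs (loops and parallel edges allowed)

record FiniteDigraph : Set₁ where
  field
    vertices : FiniteSetoid
    edges    : FiniteSetoid

  module V = FiniteSetoid vertices
  module E = FiniteSetoid edges

  field
    source : Func E.setoid V.setoid
    range  : Func E.setoid V.setoid

  s r : E.Carrier → V.Carrier
  s = Func.to source
  r = Func.to range

  IsSink : V.Carrier → Set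
  IsSink v = ∀ e → ¬ (s e V.≈ v)

  edgesFrom : V.Carrier → List E.Carrier
  edgesFrom v = filter (λ e → s e V.≟ v) E.elements

record Embedding (Γ Δ : FiniteDigraph) : Set where
  private
    module Γ = FiniteDigraph Γ
    module Δ = FiniteDigraph Δ
  field
    onVertices : Injection Γ.V.setoid Δ.V.setoid
    onEdges    : Injection Γ.E.setoid Δ.E.setoid

  vertex : Γ.V.Carrier → Δ.V.Carrier
  vertex = Injection.to onVertices

  edge : Γ.E.Carrier → Δ.E.Carrier
  edge = Injection.to onEdges

  field
    s-commutes : ∀ e → Δ.s (edge e) Δ.V.≈ vertex (Γ.s e)
    r-commutes : ∀ e → Δ.r (edge e) Δ.V.≈ vertex (Γ.r e)

module _ {Γ Γ₁ Γ₂ : FiniteDigraph} (f₁ : Embedding Γ Γ₁) (f₂ : Embedding Γ Γ₂) where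
  private
    module Γ  = FiniteDigraph Γ
    module Γ₁ = FiniteDigraph Γ₁
    module Γ₂ = FiniteDigraph Γ₂
    module f₁ = Embedding f₁
    module f₂ = Embedding f₂

  module GluedV = Gluing {Γ.vertices} {Γ₁.vertices} {Γ₂.vertices} f₁.onVertices f₂.onVertices
  module GluedE = Gluing {Γ.edges} {Γ₁.edges} {Γ₂.edges} f₁.onEdges f₂.onEdges

  private
    module V = FiniteSetoid GluedV.glued
    module E = FiniteSetoid GluedE.glued

    sᵍ rᵍ : E.Carrier → V.Carrier
    sᵍ (inj₁ e) = inj₁ (Γ₁.s e)
    sᵍ (inj₂ e) = inj₂ (Γ₂.s e)
    rᵍ (inj₁ e) = inj₁ (Γ₁.r e)
    rᵍ (inj₂ e) = inj₂ (Γ₂.r e)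

    sᵍ-cong : ∀ {e e′} → e E.≈ e′ → sᵍ e V.≈ sᵍ e′
    sᵍ-cong (GluedE.inj₁ p) = GluedV.inj₁ (Func.cong Γ₁.source p)
    sᵍ-cong (GluedE.inj₂ p) = GluedV.inj₂ (Func.cong Γ₂.source p)
    sᵍ-cong (GluedE.glue d p q) = GluedV.glue (Γ.s d)
      (Γ₁.V.trans (Γ₁.V.sym (f₁.s-commutes d)) (Func.cong Γ₁.source p))
      (Γ₂.V.trans (Γ₂.V.sym (f₂.s-commutes d)) (Func.cong Γ₂.source q))
    sᵍ-cong (GluedE.glue′ d p q) = V.sym (sᵍ-cong (GluedE.glue d p q))

    rᵍ-cong : ∀ {e e′} → e E.≈ e′ → rᵍ e V.≈ rᵍ e′
    rᵍ-cong (GluedE.inj₁ p) = GluedV.inj₁ (Func.cong Γ₁.range p)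
    rᵍ-cong (GluedE.inj₂ p) = GluedV.inj₂ (Func.cong Γ₂.range p)
    rᵍ-cong (GluedE.glue d p q) = GluedV.glue (Γ.r d)
      (Γ₁.V.trans (Γ₁.V.sym (f₁.r-commutes d)) (Func.cong Γ₁.range p))
      (Γ₂.V.trans (Γ₂.V.sym (f₂.r-commutes d)) (Func.cong Γ₂.range q))
    rᵍ-cong (GluedE.glue′ d p q) = V.sym (rᵍ-cong (GluedE.glue d p q))

  -- The graph Γ₁ ∪_Γ Γ₂.
  gluedGraph : FiniteDigraph
  gluedGraph = record
    { vertices = GluedV.glued
    ; edges    = GluedE.glued
    ; source   = record { to = sᵍ ; cong = sᵍ-cong }
    ; range    = record { to = rᵍ ; cong = rᵍ-cong }
    }

  -- A shared vertex is a sink of Γ₁ exactly when it is a sink of Γ₂.  If, say,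
  -- v ∈ V(Γ) is a sink of Γ₁ only, then g₁(v) satisfies no equation and the
  -- glued weights defined below violate the equation at v by exactly g₁(v).
  SinksAgree : Set
  SinksAgree = ∀ v → Γ₁.IsSink (f₁.vertex v) ⇔ Γ₂.IsSink (f₂.vertex v)

------------------------------------------------------------------------
-- Graph weights

module _ {c ℓ₁ ℓ₂ : Level} (ℝ : RealNumbers c ℓ₁ ℓ₂) where
  private
    module ℝ = RealNumbers ℝ
    open RealNumbers ℝ using (0#; _≈_; _#_; _≤_; _+_; _*_; _/_[_]; sum)

  record IsGraphWeight (Γ : FiniteDigraph)
                       (g  : FiniteDigraph.V.Carrier Γ → ℝ.Carrier)
                       (λᵉ : FiniteDigraph.E.Carrier Γ → ℝ.Carrier)
                       : Set (c ⊔ ℓ₁ ⊔ ℓ₂) where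
    open FiniteDigraph Γ
    field
      -- g and λᵉ are functions on the sets of vertices and of edges
      g-cong    : ∀ {v v′} → v V.≈ v′ → g v ≈ g v′
      λ-cong    : ∀ {e e′} → e E.≈ e′ → λᵉ e ≈ λᵉ e′
      g-nonneg  : ∀ v → 0# ≤ g v
      λ-nonneg  : ∀ e → 0# ≤ λᵉ e
      equation  : ∀ v → ¬ IsSink v →
                  g v ≈ sum (map (λ e → λᵉ e * g (r e)) (edgesFrom v))

  record IsFaithfulGraphWeight (Γ : FiniteDigraph)
                               (g  : FiniteDigraph.V.Carrier Γ → ℝ.Carrier)
                               (λᵉ : FiniteDigraph.E.Carrier Γ → ℝ.Carrier)
                               : Set (c ⊔ ℓ₁ ⊔ ℓ₂) where
    field
      isGraphWeight : IsGraphWeight Γ g λᵉ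
      faithful      : ∀ v → g v # 0#

    open IsGraphWeight isGraphWeight public

  module _ {Γ Γ₁ Γ₂ : FiniteDigraph} (f₁ : Embedding Γ Γ₁) (f₂ : Embedding Γ Γ₂)
    {g₁ : FiniteDigraph.V.Carrier Γ₁ → ℝ.Carrier} {λ₁ : FiniteDigraph.E.Carrier Γ₁ → ℝ.Carrier}
    {g₂ : FiniteDigraph.V.Carrier Γ₂ → ℝ.Carrier} {λ₂ : FiniteDigraph.E.Carrier Γ₂ → ℝ.Carrier}
    (w₁ : IsFaithfulGraphWeight Γ₁ g₁ λ₁) (w₂ : IsFaithfulGraphWeight Γ₂ g₂ λ₂)
    where
    private
      module Γ  = FiniteDigraph Γ
      module Γ₁ = FiniteDigraph Γ₁
      module Γ₂ = FiniteDigraph Γ₂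
      module f₁ = Embedding f₁
      module f₂ = Embedding f₂
      module w₁ = IsFaithfulGraphWeight w₁
      module w₂ = IsFaithfulGraphWeight w₂
      module G  = FiniteDigraph (gluedGraph f₁ f₂)
      module V  = GluedV f₁ f₂
      module E  = GluedE f₁ f₂

    g₁+g₂ : Γ.V.Carrier → ℝ.Carrier
    g₁+g₂ v = g₁ (f₁.vertex v) + g₂ (f₂.vertex v)

    g₁+g₂#0 : ∀ v → g₁+g₂ v # 0#
    g₁+g₂#0 v = ℝ.+-#0 (w₁.g-nonneg _) (w₁.faithful _) (w₂.g-nonneg _) (w₂.faithful _)

    gluedg : G.V.Carrier → ℝ.Carrier
    gluedg v with V.part v
    ... | V.only₁ v₁ _ = g₁ v₁
    ... | V.only₂ v₂ _ = g₂ v₂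
    ... | V.shared u   = g₁+g₂ u

    gluedλ : G.E.Carrier → ℝ.Carrier
    gluedλ e with E.part e
    ... | E.shared d = (λ₁ (f₁.edge d) * g₁ (f₁.vertex (Γ.r d)) + λ₂ (f₂.edge d) * g₂ (f₂.vertex (Γ.r d)))
                       / g₁+g₂ (Γ.r d) [ g₁+g₂#0 (Γ.r d) ]
    ... | E.only₁ e₁ _ with V.inImage₁? (Γ₁.r e₁)
    ...   | no _        = λ₁ e₁
    ...   | yes (u , _) = (λ₁ e₁ * g₁ (f₁.vertex u)) / g₁+g₂ u [ g₁+g₂#0 u ]
    gluedλ e | E.only₂ e₂ _ with V.inImage₂? (Γ₂.r e₂)
    ...   | no _        = λ₂ e₂
    ...   | yes (u , _) = (λ₂ e₂ * g₂ (f₂.vertex u)) / g₁+g₂ u [ g₁+g₂#0 u ]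

{-# OPTIONS --safe #-}

-- Write hᵢ(e) = λᵢ(e) gᵢ(r(e)), and φ₊k for the pushforward of a function k along a map φ of
-- finite sets, (φ₊k)(y) = Σ_{φ(x) = y} k(x).  With jᵢ the maps from Γᵢ to the glued graph, the
-- formulas defining (g, λ) say g = j₁₊g₁ + j₂₊g₂ and λ · (g ∘ r) = j₁₊h₁ + j₂₊h₂.  The weight
-- equation for (gᵢ, λᵢ) is gᵢ = s₊hᵢ away from sinks, and s ∘ jᵢ = jᵢ ∘ s, so functoriality of
-- the pushforward gives g = s₊(λ · (g ∘ r)).  As g is positive, cancelling g(r(e)) in the formula
-- for λ · (g ∘ r) also shows that λ is nonnegative and respects the gluing of edges.
module Submission where

open import Defs
open import Level using (Level; 0ℓ)
open import Algebra.Bundles using (CommutativeMonoid; CommutativeRing)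
import Algebra.Properties.CommutativeSemigroup as CommutativeSemigroupₚ
import Algebra.Properties.Ring as Ringₚ
open import Data.Bool.Base using (true; false)
open import Data.List.Base using (List; []; _∷_; foldr; map; filter)
open import Data.List.Properties using (filter-≐; filter-none; filter-accept; filter-reject)
import Data.List.Membership.Setoid as Membership
import Data.List.Membership.Setoid.Properties as Membershipₚ
open import Data.List.Relation.Unary.All as All using (All; []; _∷_)
open import Data.List.Relation.Unary.All.Properties using (all-filter)
open import Data.List.Relation.Unary.AllPairs using ([]; _∷_)
open import Data.List.Relation.Unary.Any using (here; there)
open import Data.List.Relation.Unary.Unique.Setoid using (Unique)
import Data.List.Relation.Unary.Unique.Setoid.Properties as Uniqueₚ
open import Data.Product.Base using (∃-syntax; _×_; _,_; proj₁)
open import Data.Sum.Base using (_⊎_; inj₁; inj₂)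
open import Function.Base using (_∘_)
open import Function.Bundles using (Func; Injection; Equivalence)
open import Function.Definitions using (Congruent; Injective)
open import Relation.Binary using (Setoid; IsStrictPartialOrder)
import Relation.Binary.PropositionalEquality as ≡
import Relation.Binary.Reasoning.Setoid as ≈-Reasoning
open import Relation.Nullary using (¬_; yes; no; does; contradiction)
open import Relation.Unary using (Pred; Decidable)

-- Finite sums in a commutative monoid.

module Sum {c ℓ} (M : CommutativeMonoid c ℓ) where
  open CommutativeMonoid M renaming
    ( Carrier to C; _∙_ to _+_; ε to 0#; ∙-cong to +-cong; ∙-congˡ to +-congˡ
    ; identityˡ to +-identityˡ; identityʳ to +-identityʳ )
  open CommutativeSemigroupₚ commutativeSemigroup using (interchange)

  sum : List C → C
  sum = foldr _+_ 0#

  module _ {A : Set} where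

    sum-cong : ∀ {h k : A → C} {xs} → All (λ x → h x ≈ k x) xs →
               sum (map h xs) ≈ sum (map k xs)
    sum-cong []       = refl
    sum-cong (p ∷ ps) = +-cong p (sum-cong ps)

    sum-zero : ∀ {h : A → C} {xs} → All (λ x → h x ≈ 0#) xs → sum (map h xs) ≈ 0#
    sum-zero []       = refl
    sum-zero (p ∷ ps) = trans (+-cong p (sum-zero ps)) (+-identityˡ 0#)

    sum-+ : ∀ (h k : A → C) xs →
            sum (map (λ x → h x + k x) xs) ≈ sum (map h xs) + sum (map k xs)
    sum-+ h k []       = sym (+-identityˡ 0#)
    sum-+ h k (x ∷ xs) =
      trans (+-congˡ (sum-+ h k xs)) (interchange (h x) (k x) _ _)

    -- The head stays under `filter` as a one-element list, so its contribution splits off uniformly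
    -- in `P?`, before anything is decided about `x`.
    sum-filter-∷ : ∀ {P : Pred A 0ℓ} (P? : Decidable P) (h : A → C) x xs →
                   sum (map h (filter P? (x ∷ xs))) ≈
                   sum (map h (filter P? (x ∷ []))) + sum (map h (filter P? xs))
    sum-filter-∷ P? h x xs with does (P? x)
    ... | true  = +-cong (sym (+-identityʳ (h x))) refl
    ... | false = sym (+-identityˡ _)

    sum-filter-accept : ∀ {P : Pred A 0ℓ} (P? : Decidable P) (h : A → C) {x} → P x →
                        sum (map h (filter P? (x ∷ []))) ≈ h x
    sum-filter-accept P? h p =
      trans (reflexive (≡.cong (sum ∘ map h) (filter-accept P? p))) (+-identityʳ _)

    sum-filter-reject : ∀ {P : Pred A 0ℓ} (P? : Decidable P) (h : A → C) {x} → ¬ P x →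
                        sum (map h (filter P? (x ∷ []))) ≈ 0#
    sum-filter-reject P? h ¬p = reflexive (≡.cong (sum ∘ map h) (filter-reject P? ¬p))

  module _ (S : Setoid 0ℓ 0ℓ) where
    private module S = Setoid S
    open Membership S using (_∈_)

    -- Uniqueness of the list leaves exactly one entry in the class of `x`, and every other entry
    -- contributes `0#`. The vanishing is asked only along `xs`, so for a filtered list it may use
    -- the filtering predicate.
    sum-concentrated : ∀ {h : S.Carrier → C} {x m xs} → Unique S xs → x ∈ xs →
                       (∀ {y} → x S.≈ y → h y ≈ m) →
                       All (λ y → ¬ (x S.≈ y) → h y ≈ 0#) xs →
                       sum (map h xs) ≈ m
    sum-concentrated (y≉ ∷ _) (here x≈y) at (_ ∷ off) =
      trans (+-cong (at x≈y) (sum-zero (All.zipWith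
              (λ (y≉z , off-z) → off-z (y≉z ∘ S.trans (S.sym x≈y))) (y≉ , off))))
            (+-identityʳ _)
    sum-concentrated (y≉ ∷ u) (there x∈) at (off-y ∷ off) =
      trans (+-cong (off-y x≉y) (sum-concentrated u x∈ at off)) (+-identityˡ _)
      where
      x≉y : ¬ (_ S.≈ _)
      x≉y x≈y = Membershipₚ.All[≉]⇒∉ S y≉ (Membershipₚ.∈-resp-≈ S x≈y x∈)

-- Pushforward of functions along maps of finite setoids.

module Pushforward {c ℓ} (M : CommutativeMonoid c ℓ) where
  open CommutativeMonoid M renaming
    ( Carrier to C; _∙_ to _+_; ε to 0#; ∙-cong to +-cong
    ; identityˡ to +-identityˡ; identityʳ to +-identityʳ )
  open Sum M

  module _ (S T : FiniteSetoid) where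
    private
      module S = FiniteSetoid S
      module T = FiniteSetoid T

    push : (S.Carrier → T.Carrier) → (S.Carrier → C) → T.Carrier → C
    push φ h t = sum (map h (filter (λ x → φ x T.≟ t) S.elements))

    module _ (φ : S.Carrier → T.Carrier) where

      -- Agreement on the fibre over `t` suffices; this allows the weight equations, which fail at
      -- sinks, to be substituted under a pushforward.
      push-cong : ∀ {h k t} → (∀ x → φ x T.≈ t → h x ≈ k x) → push φ h t ≈ push φ k t
      push-cong {t = t} h≈k =
        sum-cong (All.map (h≈k _) (all-filter (λ x → φ x T.≟ t) S.elements))

      push-resp : ∀ h {t t′} → t T.≈ t′ → push φ h t ≈ push φ h t′
      push-resp h t≈t′ = reflexive (≡.cong (sum ∘ map h) (filter-≐ _ _
        ((λ p → T.trans p t≈t′) , (λ p → T.trans p (T.sym t≈t′))) S.elements))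

      push-+ : ∀ h k t → push φ (λ x → h x + k x) t ≈ push φ h t + push φ k t
      push-+ h k t = sum-+ h k (filter (λ x → φ x T.≟ t) S.elements)

      push-∉ : ∀ {h t} → (∀ x → ¬ (φ x T.≈ t)) → push φ h t ≈ 0#
      push-∉ {h} ∉im = reflexive (≡.cong (sum ∘ map h)
        (filter-none _ (All.universal ∉im S.elements)))

      -- By injectivity the fibre over `t` is the single class of `x`, and the enumeration lists
      -- that class exactly once.
      push-injective : ∀ {h} → Congruent S._≈_ T._≈_ φ → Injective S._≈_ T._≈_ φ →
                       Congruent S._≈_ _≈_ h → ∀ {x t} → φ x T.≈ t → push φ h t ≈ h x
      push-injective {h} φ-cong φ-inj h-cong {x} {t} φx≈t = sum-concentrated S.setoid
        (Uniqueₚ.filter⁺ S.setoid over? S.unique)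
        (Membershipₚ.∈-filter⁺ S.setoid over?
          (λ x≈y p → T.trans (φ-cong (S.sym x≈y)) p) (S.complete x) φx≈t)
        (λ x≈y → h-cong (S.sym x≈y))
        (All.map (λ φy≈t x≉y → contradiction (φ-inj (T.trans φx≈t (T.sym φy≈t))) x≉y)
          (all-filter over? S.elements))
        where
        over? : Decidable (λ y → φ y T.≈ t)
        over? y = φ y T.≟ t

  module _ (S T U : FiniteSetoid) where
    private
      module S = FiniteSetoid S
      module T = FiniteSetoid T
      module U = FiniteSetoid U

    -- Both sides are additive in the list of points of `S`, so `go` inducts on that list, and only
    -- the contribution of a single point has to be compared.
    push-∘ : ∀ φ ψ → Congruent T._≈_ U._≈_ ψ → ∀ h u →
             push T U ψ (push S T φ h) u ≈ push S U (ψ ∘ φ) h u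
    push-∘ φ ψ ψ-cong h u = go S.elements
      where
      open ≈-Reasoning setoid

      over : List T.Carrier
      over = filter (λ t → ψ t U.≟ u) T.elements

      in? : ∀ t → Decidable (λ x → φ x T.≈ t)
      in? t x = φ x T.≟ t

      in′? : Decidable (λ x → ψ (φ x) U.≈ u)
      in′? x = ψ (φ x) U.≟ u

      term : List S.Carrier → T.Carrier → C
      term xs t = sum (map h (filter (in? t) xs))

      -- The contribution of `x` sits at the class of `φ x`. This class occurs once in `over` if
      -- `ψ (φ x)` is `u`, and not at all otherwise.
      point : ∀ x → sum (map (term (x ∷ [])) over) ≈ sum (map h (filter in′? (x ∷ [])))
      point x with in′? x
      ... | yes ψφx≈u = trans
        (sum-concentrated T.setoid
          (Uniqueₚ.filter⁺ T.setoid _ T.unique)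
          (Membershipₚ.∈-filter⁺ T.setoid _
            (λ t≈t′ p → U.trans (ψ-cong (T.sym t≈t′)) p) (T.complete (φ x)) ψφx≈u)
          (λ {t} → sum-filter-accept (in? t) h)
          (All.universal (λ t → sum-filter-reject (in? t) h) over))
        (sym (+-identityʳ (h x)))
      ... | no ψφx≉u = sum-zero (All.map
        (λ {t} ψt≈u → sum-filter-reject (in? t) h
          (λ φx≈t → ψφx≉u (U.trans (ψ-cong φx≈t) ψt≈u)))
        (all-filter _ T.elements))

      go : ∀ xs → sum (map (term xs) over) ≈ sum (map h (filter in′? xs))
      go []       = sum-zero (All.universal (λ _ → refl) over)
      go (x ∷ xs) = begin
        sum (map (term (x ∷ xs)) over)
          ≈⟨ sum-cong (All.universal (λ t → sum-filter-∷ (in? t) h x xs) over) ⟩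
        sum (map (λ t → term (x ∷ []) t + term xs t) over)
          ≈⟨ sum-+ _ _ over ⟩
        sum (map (term (x ∷ [])) over) + sum (map (term xs) over)
          ≈⟨ +-cong (point x) (go xs) ⟩
        sum (map h (filter in′? (x ∷ []))) + sum (map h (filter in′? xs))
          ≈⟨ sum-filter-∷ in′? h x xs ⟨
        sum (map h (filter in′? (x ∷ xs))) ∎

-- Functions on a glued set.

module GluingProperties
  {A B₁ B₂ : FiniteSetoid}
  (ι₁ : Injection (FiniteSetoid.setoid A) (FiniteSetoid.setoid B₁))
  (ι₂ : Injection (FiniteSetoid.setoid A) (FiniteSetoid.setoid B₂))
  where
  private
    module B₁ = FiniteSetoid B₁
    module B₂ = FiniteSetoid B₂
    module ι₁ = Injection ι₁
    module ι₂ = Injection ι₂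
  open Gluing {A} {B₁} {B₂} ι₁ ι₂
  private module G = FiniteSetoid glued

  -- Case analysis on `part z` alone forgets how the result is related to `z`; this predicate
  -- retains that the chosen representatives lie in the class of `z`.
  Locates : Part → G.Carrier → Set
  Locates (only₁ x _) z = inj₁ x ~ z
  Locates (only₂ y _) z = inj₂ y ~ z
  Locates (shared a)  z = inj₁ (ι₁.to a) ~ z × inj₂ (ι₂.to a) ~ z

  part-locates : ∀ z → Locates (part z) z
  part-locates (inj₁ x) with inImage₁? x
  ... | yes (a , p) = inj₁ p , glue′ a p B₂.refl
  ... | no _        = inj₁ B₁.refl
  part-locates (inj₂ y) with inImage₂? y
  ... | yes (a , p) = glue a B₁.refl p , inj₂ p
  ... | no _        = inj₂ B₂.refl

  module Merge {c ℓ} (M : CommutativeMonoid c ℓ)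
    (k₁ : B₁.Carrier → CommutativeMonoid.Carrier M)
    (k₁-cong : Congruent B₁._≈_ (CommutativeMonoid._≈_ M) k₁)
    (k₂ : B₂.Carrier → CommutativeMonoid.Carrier M)
    (k₂-cong : Congruent B₂._≈_ (CommutativeMonoid._≈_ M) k₂)
    where
    open CommutativeMonoid M renaming
      ( Carrier to C; _∙_ to _+_; ∙-cong to +-cong
      ; identityˡ to +-identityˡ; identityʳ to +-identityʳ )
    open Pushforward M

    -- A formula by cases on `part z` depends on the representative `z` and on the preimage found by
    -- search. Here `z` enters only through fibres taken with respect to `_~_`, so invariance under
    -- gluing is immediate, and formulas equal to a `merge` inherit it.
    merge : G.Carrier → C
    merge z = push B₁ glued inj₁ k₁ z + push B₂ glued inj₂ k₂ z

    merge-resp : ∀ {z z′} → z ~ z′ → merge z ≈ merge z′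
    merge-resp z~z′ =
      +-cong (push-resp B₁ glued inj₁ k₁ z~z′) (push-resp B₂ glued inj₂ k₂ z~z′)

    private
      at₁ : ∀ {x z} → inj₁ x ~ z → push B₁ glued inj₁ k₁ z ≈ k₁ x
      at₁ = push-injective B₁ glued inj₁ inj₁ (λ { (inj₁ p) → p }) k₁-cong

      at₂ : ∀ {y z} → inj₂ y ~ z → push B₂ glued inj₂ k₂ z ≈ k₂ y
      at₂ = push-injective B₂ glued inj₂ inj₂ (λ { (inj₂ p) → p }) k₂-cong

    -- Only `glue` relates the two sides, and it needs a point of `A`. So a class with a
    -- representative in `B₁` outside `A` has an empty fibre in `B₂`.
    merge-only₁ : ∀ {x z} → ¬ (∃[ a ] ι₁.to a B₁.≈ x) → inj₁ x ~ z → merge z ≈ k₁ x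
    merge-only₁ x∉A x~z = trans
      (+-cong (at₁ x~z) (push-∉ B₂ glued inj₂ λ y y~z → absurd (G.trans x~z (G.sym y~z))))
      (+-identityʳ _)
      where
      absurd : ∀ {y} → ¬ (inj₁ _ ~ inj₂ y)
      absurd (glue a p _) = x∉A (a , p)

    merge-only₂ : ∀ {y z} → ¬ (∃[ a ] ι₂.to a B₂.≈ y) → inj₂ y ~ z → merge z ≈ k₂ y
    merge-only₂ y∉A y~z = trans
      (+-cong (push-∉ B₁ glued inj₁ λ x x~z → absurd (G.trans x~z (G.sym y~z))) (at₂ y~z))
      (+-identityˡ _)
      where
      absurd : ∀ {x} → ¬ (inj₁ x ~ inj₂ _)
      absurd (glue a _ q) = y∉A (a , q)

    merge-shared : ∀ {a z} → inj₁ (ι₁.to a) ~ z × inj₂ (ι₂.to a) ~ z →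
                   merge z ≈ k₁ (ι₁.to a) + k₂ (ι₂.to a)
    merge-shared (p , q) = +-cong (at₁ p) (at₂ q)

-- Order and division in the reals, without deciding signs.

module RealProperties {c ℓ₁ ℓ₂} (ℝ : RealNumbers c ℓ₁ ℓ₂) where
  open RealNumbers ℝ
  open Ringₚ (CommutativeRing.ring commutativeRing) using (-0#≈0#; -‿distribˡ-*)
  open CommutativeSemigroupₚ
    (CommutativeRing.*-commutativeSemigroup commutativeRing) using (xy∙z≈xz∙y)
  private module < = IsStrictPartialOrder isStrictPartialOrder

  -- Since `_≤_` is a negation, the two hypotheses refute `x # y`, and tightness of the apartness
  -- gives equality.
  ≤-antisym : ∀ {x y} → x ≤ y → y ≤ x → x ≈ y
  ≤-antisym {x} {y} x≤y y≤x = proj₁ (tight x y) λ x#y → case (#⇒<⊎> x#y)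
    where
    case : ¬ (x < y ⊎ y < x)
    case (inj₁ x<y) = y≤x x<y
    case (inj₂ y<x) = x≤y y<x

  nonneg-resp : ∀ {x y} → x ≈ y → 0# ≤ x → 0# ≤ y
  nonneg-resp x≈y 0≤x y<0 = 0≤x (<.<-respˡ-≈ (sym x≈y) y<0)

  -- Suppose `x + y < 0#`. A positive `y` would give `x < x + y < 0#`, so `y` is zero by
  -- antisymmetry, and then `x` itself is negative.
  nonneg-+ : ∀ {x y} → 0# ≤ x → 0# ≤ y → 0# ≤ x + y
  nonneg-+ {x} {y} 0≤x 0≤y x+y<0 =
    0≤x (<.<-respˡ-≈ (trans (+-congˡ y≈0) (+-identityʳ x)) x+y<0)
    where
    y≈0 : y ≈ 0#
    y≈0 = ≤-antisym
      (λ 0<y → 0≤x (<.trans (<.<-respʳ-≈ (+-comm y x)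
        (<.<-respˡ-≈ (+-identityˡ x) (+-monoˡ-< x 0<y))) x+y<0)) 0≤y

  -- Suppose `x * y < 0#`. If `0# < x`, then `y` cannot be positive, hence is zero, and the product
  -- vanishes; so `x` is zero, and the product vanishes again.
  nonneg-* : ∀ {x y} → 0# ≤ x → 0# ≤ y → 0# ≤ x * y
  nonneg-* {x} {y} 0≤x 0≤y xy<0 = <.irrefl (trans (*-congʳ x≈0) (zeroˡ y)) xy<0
    where
    x≈0 : x ≈ 0#
    x≈0 = ≤-antisym (λ 0<x → <.irrefl
      (trans (*-congˡ (≤-antisym (λ 0<y → <.asym (*-pos 0<x 0<y) xy<0) 0≤y)) (zeroʳ x))
      xy<0) 0≤x

  pos : ∀ {x} → 0# ≤ x → x # 0# → 0# < x
  pos 0≤x x#0 with #⇒<⊎> x#0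
  ... | inj₁ x<0 = contradiction x<0 0≤x
  ... | inj₂ 0<x = 0<x

  *-cancelʳ-nonneg : ∀ {x y} → 0# < y → 0# ≤ x * y → 0# ≤ x
  *-cancelʳ-nonneg {x} {y} 0<y 0≤xy x<0 = 0≤xy (<.<-respˡ-≈ (+-identityˡ (x * y))
    (<.<-respʳ-≈ -xy+xy≈0 (+-monoˡ-< (x * y) 0<-xy)))
    where
    0<-x : 0# < - x
    0<-x = <.<-respˡ-≈ (-‿inverseʳ x) (<.<-respʳ-≈ (+-identityˡ (- x)) (+-monoˡ-< (- x) x<0))

    0<-xy : 0# < - (x * y)
    0<-xy = <.<-respʳ-≈ (sym (-‿distribˡ-* x y)) (*-pos 0<-x 0<y)

    -xy+xy≈0 : - (x * y) + x * y ≈ 0#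
    -xy+xy≈0 = -‿inverseˡ (x * y)

  sum-nonneg : ∀ {A : Set} {h : A → Carrier} → (∀ x → 0# ≤ h x) →
               ∀ xs → 0# ≤ sum (map h xs)
  sum-nonneg 0≤h []       = <.irrefl refl
  sum-nonneg 0≤h (x ∷ xs) = nonneg-+ (0≤h x) (sum-nonneg 0≤h xs)

  module _ (S T : FiniteSetoid) where
    private
      module S = FiniteSetoid S
      module T = FiniteSetoid T
    open Pushforward (CommutativeRing.+-commutativeMonoid commutativeRing)

    push-nonneg : ∀ φ {h} → (∀ x → 0# ≤ h x) → ∀ t → 0# ≤ push S T φ h t
    push-nonneg φ 0≤h t = sum-nonneg 0≤h (filter (λ x → φ x T.≟ t) S.elements)

  /-*-cancel : ∀ x {y} (y#0 : y # 0#) → x / y [ y#0 ] * y ≈ x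
  /-*-cancel x {y} y#0 with #⇒invertible y#0
  ... | y⁻¹ , y⁻¹y≈1 , _ = begin
    x * y⁻¹ * y          ≈⟨ *-assoc x y⁻¹ y ⟩
    -- The inverse supplied by the apartness `y # 0#` is that of `y - 0#`.
    x * (y⁻¹ * y)        ≈⟨ *-congˡ (*-congˡ (trans (+-congˡ -0#≈0#) (+-identityʳ y))) ⟨
    x * (y⁻¹ * (y - 0#)) ≈⟨ *-congˡ y⁻¹y≈1 ⟩
    x * 1#               ≈⟨ *-identityʳ x ⟩
    x                    ∎
    where open ≈-Reasoning setoid

  *-cancelʳ : ∀ {x x′ y} → y # 0# → x * y ≈ x′ * y → x ≈ x′
  *-cancelʳ {x} {x′} {y} y#0 xy≈x′y = begin
    x                     ≈⟨ /-*-cancel x y#0 ⟨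
    x / y [ y#0 ] * y     ≈⟨ xy∙z≈xz∙y x _ y ⟩
    (x * y) / y [ y#0 ]   ≈⟨ *-congʳ xy≈x′y ⟩
    (x′ * y) / y [ y#0 ]  ≈⟨ xy∙z≈xz∙y x′ y _ ⟩
    x′ / y [ y#0 ] * y    ≈⟨ /-*-cancel x′ y#0 ⟩
    x′                    ∎
    where open ≈-Reasoning setoid

-- The glued functions as pushforwards.

module GluedWeight {c ℓ₁ ℓ₂ : Level} (ℝ : RealNumbers c ℓ₁ ℓ₂)
  {Γ Γ₁ Γ₂ : FiniteDigraph} (f₁ : Embedding Γ Γ₁) (f₂ : Embedding Γ Γ₂)
  {g₁ : FiniteDigraph.V.Carrier Γ₁ → RealNumbers.Carrier ℝ}
  {λ₁ : FiniteDigraph.E.Carrier Γ₁ → RealNumbers.Carrier ℝ}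
  {g₂ : FiniteDigraph.V.Carrier Γ₂ → RealNumbers.Carrier ℝ}
  {λ₂ : FiniteDigraph.E.Carrier Γ₂ → RealNumbers.Carrier ℝ}
  (w₁ : IsFaithfulGraphWeight ℝ Γ₁ g₁ λ₁) (w₂ : IsFaithfulGraphWeight ℝ Γ₂ g₂ λ₂)
  where
  open RealNumbers ℝ
  open RealProperties ℝ
  open ≈-Reasoning setoid

  private
    module Γ  = FiniteDigraph Γ
    module Γ₁ = FiniteDigraph Γ₁
    module Γ₂ = FiniteDigraph Γ₂
    module f₁ = Embedding f₁
    module f₂ = Embedding f₂
    module w₁ = IsFaithfulGraphWeight w₁
    module w₂ = IsFaithfulGraphWeight w₂
    module G  = FiniteDigraph (gluedGraph f₁ f₂)
    module V  = GluedV f₁ f₂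
    module E  = GluedE f₁ f₂
    module Vₚ = GluingProperties {Γ.vertices} {Γ₁.vertices} {Γ₂.vertices}
                  f₁.onVertices f₂.onVertices
    module Eₚ = GluingProperties {Γ.edges} {Γ₁.edges} {Γ₂.edges} f₁.onEdges f₂.onEdges
    +-monoid = CommutativeRing.+-commutativeMonoid commutativeRing
  open Pushforward +-monoid

  g : G.V.Carrier → Carrier
  g = gluedg ℝ f₁ f₂ w₁ w₂

  λᵍ : G.E.Carrier → Carrier
  λᵍ = gluedλ ℝ f₁ f₂ w₁ w₂

  h₁ : Γ₁.E.Carrier → Carrier
  h₁ e = λ₁ e * g₁ (Γ₁.r e)

  h₂ : Γ₂.E.Carrier → Carrier
  h₂ e = λ₂ e * g₂ (Γ₂.r e)

  h₁-cong : Congruent Γ₁.E._≈_ _≈_ h₁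
  h₁-cong p = *-cong (w₁.λ-cong p) (w₁.g-cong (Func.cong Γ₁.range p))

  h₂-cong : Congruent Γ₂.E._≈_ _≈_ h₂
  h₂-cong p = *-cong (w₂.λ-cong p) (w₂.g-cong (Func.cong Γ₂.range p))

  private
    module gₘ = Vₚ.Merge +-monoid g₁ w₁.g-cong g₂ w₂.g-cong
    module hₘ = Eₚ.Merge +-monoid h₁ h₁-cong h₂ h₂-cong

  -- The three cases for `g` are the values of `merge` on a class met by one side only or by both.
  g-merge : ∀ v → g v ≈ gₘ.merge v
  g-merge v with V.part v | Vₚ.part-locates v
  ... | V.only₁ x x∉Γ | p = sym (gₘ.merge-only₁ x∉Γ p)
  ... | V.only₂ y y∉Γ | p = sym (gₘ.merge-only₂ y∉Γ p)
  ... | V.shared u    | p = sym (gₘ.merge-shared p)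

  g-resp : ∀ {v v′} → v G.V.≈ v′ → g v ≈ g v′
  g-resp {v} {v′} p = trans (g-merge v)
    (trans (gₘ.merge-resp p) (sym (g-merge v′)))

  g-only₁ : ∀ {x v} → ¬ (∃[ u ] f₁.vertex u Γ₁.V.≈ x) → inj₁ x G.V.≈ v → g v ≈ g₁ x
  g-only₁ x∉Γ p = trans (g-merge _)
    (gₘ.merge-only₁ x∉Γ p)

  g-only₂ : ∀ {y v} → ¬ (∃[ u ] f₂.vertex u Γ₂.V.≈ y) → inj₂ y G.V.≈ v → g v ≈ g₂ y
  g-only₂ y∉Γ p = trans (g-merge _)
    (gₘ.merge-only₂ y∉Γ p)

  g-shared : ∀ {u v} → inj₁ (f₁.vertex u) G.V.≈ v → g v ≈ g₁+g₂ ℝ f₁ f₂ w₁ w₂ u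
  g-shared {u} p = trans (g-merge _)
    (gₘ.merge-shared
      (p , G.V.trans (V.glue′ u Γ₁.V.refl Γ₂.V.refl) p))

  g-faithful : ∀ v → g v # 0#
  g-faithful v with V.part v
  ... | V.only₁ x _ = w₁.faithful x
  ... | V.only₂ y _ = w₂.faithful y
  ... | V.shared u  = g₁+g₂#0 ℝ f₁ f₂ w₁ w₂ u

  g-nonneg : ∀ v → 0# ≤ g v
  g-nonneg v = nonneg-resp (sym (g-merge v))
    (nonneg-+ (push-nonneg Γ₁.vertices G.vertices inj₁ w₁.g-nonneg v)
              (push-nonneg Γ₂.vertices G.vertices inj₂ w₂.g-nonneg v))

  -- Each denominator in the formula for `λᵍ` is `g` at the range of the edge, so multiplying leaves
  -- the numerator. Where there is no denominator, the range lies outside Γ and `g` equals the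
  -- original weight there. An edge outside Γ may still end in Γ, hence the inner case split.
  λg-merge : ∀ e → λᵍ e * g (G.r e) ≈ hₘ.merge e
  λg-merge e with E.part e | Eₚ.part-locates e
  ... | E.shared d | p = begin
    _ * g (G.r e)
      ≈⟨ *-congˡ (g-shared (G.V.trans (V.inj₁ (Γ₁.V.sym (f₁.r-commutes d)))
                                      (Func.cong G.range (proj₁ p)))) ⟩
    _ * g₁+g₂ ℝ f₁ f₂ w₁ w₂ (Γ.r d)
      ≈⟨ /-*-cancel _ (g₁+g₂#0 ℝ f₁ f₂ w₁ w₂ (Γ.r d)) ⟩
    λ₁ (f₁.edge d) * g₁ (f₁.vertex (Γ.r d)) + λ₂ (f₂.edge d) * g₂ (f₂.vertex (Γ.r d))
      ≈⟨ +-cong (*-congˡ (w₁.g-cong (f₁.r-commutes d)))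
                (*-congˡ (w₂.g-cong (f₂.r-commutes d))) ⟨
    h₁ (f₁.edge d) + h₂ (f₂.edge d)
      ≈⟨ hₘ.merge-shared p ⟨
    hₘ.merge e ∎
  ... | E.only₁ e₁ e₁∉Γ | p with V.inImage₁? (Γ₁.r e₁)
  ...   | no r∉Γ = trans (*-congˡ (g-only₁ r∉Γ (Func.cong G.range p)))
                     (sym (hₘ.merge-only₁ e₁∉Γ p))
  ...   | yes (u , q) = begin
    _ * g (G.r e)
      ≈⟨ *-congˡ (g-shared (G.V.trans (V.inj₁ q) (Func.cong G.range p))) ⟩
    _ * g₁+g₂ ℝ f₁ f₂ w₁ w₂ u
      ≈⟨ /-*-cancel _ (g₁+g₂#0 ℝ f₁ f₂ w₁ w₂ u) ⟩
    λ₁ e₁ * g₁ (f₁.vertex u)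
      ≈⟨ *-congˡ (w₁.g-cong q) ⟩
    h₁ e₁
      ≈⟨ hₘ.merge-only₁ e₁∉Γ p ⟨
    hₘ.merge e ∎
  λg-merge e | E.only₂ e₂ e₂∉Γ | p with V.inImage₂? (Γ₂.r e₂)
  ...   | no r∉Γ = trans (*-congˡ (g-only₂ r∉Γ (Func.cong G.range p)))
                     (sym (hₘ.merge-only₂ e₂∉Γ p))
  ...   | yes (u , q) = begin
    _ * g (G.r e)
      -- `g-shared` expects the image of `u` in Γ₁; `V.glue` leads from it to the range of `e₂` in
      -- Γ₂.
      ≈⟨ *-congˡ (g-shared (G.V.trans (V.glue u Γ₁.V.refl q) (Func.cong G.range p))) ⟩
    _ * g₁+g₂ ℝ f₁ f₂ w₁ w₂ u
      ≈⟨ /-*-cancel _ (g₁+g₂#0 ℝ f₁ f₂ w₁ w₂ u) ⟩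
    λ₂ e₂ * g₂ (f₂.vertex u)
      ≈⟨ *-congˡ (w₂.g-cong q) ⟩
    h₂ e₂
      ≈⟨ hₘ.merge-only₂ e₂∉Γ p ⟨
    hₘ.merge e ∎

  λ-resp : ∀ {e e′} → e G.E.≈ e′ → λᵍ e ≈ λᵍ e′
  λ-resp {e} {e′} p = *-cancelʳ (g-faithful (G.r e)) (begin
    λᵍ e * g (G.r e)              ≈⟨ λg-merge e ⟩
    hₘ.merge e     ≈⟨ hₘ.merge-resp p ⟩
    hₘ.merge e′    ≈⟨ λg-merge e′ ⟨
    λᵍ e′ * g (G.r e′)            ≈⟨ *-congˡ (g-resp (Func.cong G.range p)) ⟨
    λᵍ e′ * g (G.r e)             ∎)

  λ-nonneg : ∀ e → 0# ≤ λᵍ e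
  λ-nonneg e = *-cancelʳ-nonneg (pos (g-nonneg (G.r e)) (g-faithful (G.r e)))
    (nonneg-resp (sym (λg-merge e)) (nonneg-+
      (push-nonneg Γ₁.edges G.edges inj₁
        (λ d → nonneg-* (w₁.λ-nonneg d) (w₁.g-nonneg (Γ₁.r d))) e)
      (push-nonneg Γ₂.edges G.edges inj₂
        (λ d → nonneg-* (w₂.λ-nonneg d) (w₂.g-nonneg (Γ₂.r d))) e)))

  -- The weight equation on the glued graph.

  module _ (agree : SinksAgree f₁ f₂) where

    -- In contrapositive form this supplies the condition of the equation in Γ₁. An edge of Γ₂
    -- starting at the class of `x` forces `x` to be shared, and then `agree` makes the
    -- corresponding vertex a sink of Γ₂, which excludes the edge.
    sink₁⇒sink : ∀ {x v} → inj₁ x G.V.≈ v → Γ₁.IsSink x → G.IsSink v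
    sink₁⇒sink {x} {v} p sink e q = no-edge e (G.V.trans q (G.V.sym p))
      where
      no-edge : ∀ e → ¬ (G.s e G.V.≈ inj₁ x)
      no-edge (inj₁ e₁) (V.inj₁ p) = sink e₁ p
      no-edge (inj₂ e₂) (V.glue′ u p q) = Equivalence.to (agree u)
        (λ d d→u → sink d (Γ₁.V.trans d→u p)) e₂ (Γ₂.V.sym q)

    sink₂⇒sink : ∀ {y v} → inj₂ y G.V.≈ v → Γ₂.IsSink y → G.IsSink v
    sink₂⇒sink {y} {v} p sink e q = no-edge e (G.V.trans q (G.V.sym p))
      where
      no-edge : ∀ e → ¬ (G.s e G.V.≈ inj₂ y)
      no-edge (inj₂ e₂) (V.inj₂ p) = sink e₂ p
      no-edge (inj₁ e₁) (V.glue u p q) = Equivalence.from (agree u)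
        (λ d d→u → sink d (Γ₂.V.trans d→u q)) e₁ (Γ₁.V.sym p)

    -- The equation is applied at each representative of `v` in Γ₁. If there is none, the first step
    -- is vacuous, so no case split on the position of `v` is needed.
    equation₁ : ∀ v → ¬ G.IsSink v →
                push Γ₁.vertices G.vertices inj₁ g₁ v ≈
                push G.edges G.vertices G.s (push Γ₁.edges G.edges inj₁ h₁) v
    equation₁ v ¬sink = begin
      push Γ₁.vertices G.vertices inj₁ g₁ v
        ≈⟨ push-cong Γ₁.vertices G.vertices inj₁
             (λ x p → w₁.equation x (¬sink ∘ sink₁⇒sink p)) ⟩
      push Γ₁.vertices G.vertices inj₁ (push Γ₁.edges Γ₁.vertices Γ₁.s h₁) v
        ≈⟨ push-∘ Γ₁.edges Γ₁.vertices G.vertices Γ₁.s inj₁ V.inj₁ h₁ v ⟩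
      -- The two uses of `push-∘` meet here because `G.s ∘ inj₁` and `inj₁ ∘ Γ₁.s` are
      -- definitionally equal.
      push Γ₁.edges G.vertices (inj₁ ∘ Γ₁.s) h₁ v
        ≈⟨ push-∘ Γ₁.edges G.edges G.vertices inj₁ G.s (Func.cong G.source) h₁ v ⟨
      push G.edges G.vertices G.s (push Γ₁.edges G.edges inj₁ h₁) v ∎

    equation₂ : ∀ v → ¬ G.IsSink v →
                push Γ₂.vertices G.vertices inj₂ g₂ v ≈
                push G.edges G.vertices G.s (push Γ₂.edges G.edges inj₂ h₂) v
    equation₂ v ¬sink = begin
      push Γ₂.vertices G.vertices inj₂ g₂ v
        ≈⟨ push-cong Γ₂.vertices G.vertices inj₂
             (λ y p → w₂.equation y (¬sink ∘ sink₂⇒sink p)) ⟩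
      push Γ₂.vertices G.vertices inj₂ (push Γ₂.edges Γ₂.vertices Γ₂.s h₂) v
        ≈⟨ push-∘ Γ₂.edges Γ₂.vertices G.vertices Γ₂.s inj₂ V.inj₂ h₂ v ⟩
      push Γ₂.edges G.vertices (inj₂ ∘ Γ₂.s) h₂ v
        ≈⟨ push-∘ Γ₂.edges G.edges G.vertices inj₂ G.s (Func.cong G.source) h₂ v ⟨
      push G.edges G.vertices G.s (push Γ₂.edges G.edges inj₂ h₂) v ∎

    equation : ∀ v → ¬ G.IsSink v →
               g v ≈ push G.edges G.vertices G.s (λ e → λᵍ e * g (G.r e)) v
    equation v ¬sink = begin
      g v
        ≈⟨ g-merge v ⟩
      gₘ.merge v
        ≈⟨ +-cong (equation₁ v ¬sink) (equation₂ v ¬sink) ⟩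
      push G.edges G.vertices G.s (push Γ₁.edges G.edges inj₁ h₁) v +
      push G.edges G.vertices G.s (push Γ₂.edges G.edges inj₂ h₂) v
        ≈⟨ push-+ G.edges G.vertices G.s _ _ v ⟨
      push G.edges G.vertices G.s (hₘ.merge) v
        ≈⟨ push-cong G.edges G.vertices G.s (λ e _ → λg-merge e) ⟨
      push G.edges G.vertices G.s (λ e → λᵍ e * g (G.r e)) v ∎

    isFaithfulGraphWeight : IsFaithfulGraphWeight ℝ (gluedGraph f₁ f₂) g λᵍ
    isFaithfulGraphWeight = record
      { isGraphWeight = record
        { g-cong   = g-resp
        ; λ-cong   = λ-resp
        ; g-nonneg = g-nonneg
        ; λ-nonneg = λ-nonneg
        ; equation = equation
        }
      ; faithful = g-faithful
      }

proposition5p1 : ∀ {c ℓ₁ ℓ₂ : Level} (ℝ : RealNumbers c ℓ₁ ℓ₂)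
    {Γ Γ₁ Γ₂ : FiniteDigraph} (f₁ : Embedding Γ Γ₁) (f₂ : Embedding Γ Γ₂) →
    SinksAgree f₁ f₂ →
    {g₁ : FiniteDigraph.V.Carrier Γ₁ → RealNumbers.Carrier ℝ}
    {λ₁ : FiniteDigraph.E.Carrier Γ₁ → RealNumbers.Carrier ℝ}
    {g₂ : FiniteDigraph.V.Carrier Γ₂ → RealNumbers.Carrier ℝ}
    {λ₂ : FiniteDigraph.E.Carrier Γ₂ → RealNumbers.Carrier ℝ}
    (w₁ : IsFaithfulGraphWeight ℝ Γ₁ g₁ λ₁) (w₂ : IsFaithfulGraphWeight ℝ Γ₂ g₂ λ₂) →
    IsFaithfulGraphWeight ℝ (gluedGraph f₁ f₂) (gluedg ℝ f₁ f₂ w₁ w₂) (gluedλ ℝ f₁ f₂ w₁ w₂)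
proposition5p1 ℝ f₁ f₂ agree w₁ w₂ =
  GluedWeight.isFaithfulGraphWeight ℝ f₁ f₂ w₁ w₂ agree
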